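{- Any nonconstant unitary perfect polynomial over $\mathbb{F}_2$ is divisible by $x$ and by $x+1$. In particular, there is no odd nonconstant unitary perfect polynomial over $\mathbb{F}_2$.
   Context: For a nonzero polynomial $A \in \mathbb{F}_2[x]$, a divisor $d$ of $A$ is called unitary if $d$ is monic and $\gcd(d, A/d) = 1$. $\sigma^*(A)$ denotes the sum of all unitary divisors of $A$. The polynomial $A$ is called unitary perfect if $\sigma^*(A) = A$. A polynomial over $\mathbb{F}_2$ is called even if it has some zero in $\mathbb{F}_2$, and odd if it is not even. -}

module Defs where

open import Algebra.Bundles.Raw using (RawSemiring)
import Algebra.Definitions.RawMagma as MagmaDefs
import Algebra.Definitions.RawSemiring as SemiringDefs
open import Data.Bool.Base using (Bool; true; false; _∧_; _xor_)
import Data.Bool.Properties as Bool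
open import Data.Empty using (⊥-elim)
open import Data.List.Base using (List; []; _∷_; _++_; map; filter; foldr; length)
open import Data.List.Membership.Propositional using (_∈_; find; lose)
open import Data.List.Membership.Propositional.Properties
  using (∈-map⁺; ∈-++⁺ˡ; ∈-++⁺ʳ; ∈-filter⁺; ∈-filter⁻)
open import Data.List.Relation.Unary.All as All using (All)
import Data.List.Relation.Unary.All.Properties as All
open import Data.List.Relation.Unary.AllPairs as AllPairs using (AllPairs)
import Data.List.Relation.Unary.AllPairs.Properties as AllPairs
import Data.List.Relation.Unary.Any as Any
open import Data.List.Relation.Unary.Any using (here)
open import Data.Nat.Base as ℕ using (ℕ; zero; suc; z≤n; s≤s; s<s⁻¹)
import Data.Nat.Properties as ℕ
open import Data.Product.Base using (∃; _×_; _,_; proj₁; proj₂)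
open import Data.Sum.Base using (_⊎_; inj₁; inj₂)
open import Level using (0ℓ)
open import Relation.Binary.PropositionalEquality
  using (_≡_; refl; sym; trans; cong; cong₂; subst)
open import Relation.Nullary using (¬_; Dec; yes; no)
open import Relation.Nullary.Decidable using (map′; _→-dec_; _×-dec_)
open import Relation.Unary using (Decidable)

-- The field with two elements, with addition _xor_ and multiplication _∧_
-- (the ring xor-∧-commutativeRing of Data.Bool.Properties).
𝔽₂ : Set
𝔽₂ = Bool

-- Coefficient lists, constant term first. Trailing zeros are allowed, so
-- polynomials are compared with _≈_ rather than _≡_.
Poly : Set
Poly = List 𝔽₂

coeff : Poly → ℕ → 𝔽₂
coeff []      _       = false
coeff (a ∷ p) zero    = a
coeff (a ∷ p) (suc i) = coeff p i

infix 4 _≈_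
_≈_ : Poly → Poly → Set
p ≈ q = ∀ i → coeff p i ≡ coeff q i

infixl 6 _+_
_+_ : Poly → Poly → Poly
[]      + q       = q
(a ∷ p) + []      = a ∷ p
(a ∷ p) + (b ∷ q) = (a xor b) ∷ (p + q)

infixl 7 _*_
_*_ : Poly → Poly → Poly
[]      * q = []
(a ∷ p) * q = map (a ∧_) q + (false ∷ (p * q))

𝔽₂[x] : RawSemiring 0ℓ 0ℓ
𝔽₂[x] = record
  { Carrier = Poly
  ; _≈_     = _≈_
  ; _+_     = _+_
  ; _*_     = _*_
  ; 0#      = []
  ; 1#      = true ∷ []
  }

open RawSemiring 𝔽₂[x] public using (0#; 1#; _≉_)
open SemiringDefs 𝔽₂[x] public using (_∣_; _∤_)
open MagmaDefs (RawSemiring.*-rawMagma 𝔽₂[x]) using (_,_)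

X : Poly
X = false ∷ true ∷ []

Constant : Poly → Set
Constant A = ∃ λ c → A ≈ (c ∷ [])

Monic : Poly → Set
Monic p = ∃ λ n → coeff p n ≡ true × (∀ i → n ℕ.< i → coeff p i ≡ false)

eval : Poly → 𝔽₂ → 𝔽₂
eval []      c = false
eval (a ∷ p) c = a xor (c ∧ eval p c)

Even : Poly → Set
Even A = ∃ λ c → eval A c ≡ false

Odd : Poly → Set
Odd A = ¬ Even A

record IsGCD (a b g : Poly) : Set where
  field
    monic    : Monic g
    divides₁ : g ∣ a
    divides₂ : g ∣ b
    greatest : ∀ e → e ∣ a → e ∣ b → e ∣ g

-- The witness q is the quotient A/d.
UnitaryDivisor : Poly → Poly → Set
UnitaryDivisor A d = Monic d × ∃ λ q → q * d ≈ A × IsGCD d q 1#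

-- All coefficient lists of length n. Every polynomial of degree < n is
-- represented by exactly one of them (polys-complete, polys-unique).
polys : ℕ → List Poly
polys zero    = [] ∷ []
polys (suc n) = map (false ∷_) (polys n) ++ map (true ∷_) (polys n)

------------------------------------------------------------------------
-- Decidability of UnitaryDivisor, by bounded search

≈-sym : ∀ p q → p ≈ q → q ≈ p
≈-sym p q e i = sym (e i)

≈-trans : ∀ p q r → p ≈ q → q ≈ r → p ≈ r
≈-trans p q r e f i = trans (e i) (f i)

coeff-+ : ∀ p q i → coeff (p + q) i ≡ coeff p i xor coeff q i
coeff-+ []      q       i       = refl
coeff-+ (a ∷ p) []      i       = sym (Bool.xor-identityʳ _)
coeff-+ (a ∷ p) (b ∷ q) zero    = refl
coeff-+ (a ∷ p) (b ∷ q) (suc i) = coeff-+ p q i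

coeff-scale : ∀ a q i → coeff (map (a ∧_) q) i ≡ a ∧ coeff q i
coeff-scale a []      i       = sym (Bool.∧-zeroʳ a)
coeff-scale a (b ∷ q) zero    = refl
coeff-scale a (b ∷ q) (suc i) = coeff-scale a q i

coeff-* : ∀ a p q i →
          coeff ((a ∷ p) * q) i ≡ (a ∧ coeff q i) xor coeff (false ∷ (p * q)) i
coeff-* a p q i = trans (coeff-+ (map (a ∧_) q) (false ∷ (p * q)) i)
                        (cong (_xor coeff (false ∷ (p * q)) i) (coeff-scale a q i))

∷-cong : ∀ a p q → p ≈ q → (a ∷ p) ≈ (a ∷ q)
∷-cong a p q e zero    = refl
∷-cong a p q e (suc i) = e i

*-zeroˡ : ∀ p q → p ≈ [] → p * q ≈ []
*-zeroˡ []      q e i = refl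
*-zeroˡ (a ∷ p) q e i with e 0
... | refl = trans (coeff-* false p q i) (shifted i)
  where
  shifted : ∀ i → coeff (false ∷ (p * q)) i ≡ false
  shifted zero    = refl
  shifted (suc i) = *-zeroˡ p q (λ j → e (suc j)) i

*-zeroʳ : ∀ p q → q ≈ [] → p * q ≈ []
*-zeroʳ []      q e i = refl
*-zeroʳ (a ∷ p) q e i = trans (coeff-* a p q i)
  (cong₂ _xor_ (trans (cong (a ∧_) (e i)) (Bool.∧-zeroʳ a)) (shifted i))
  where
  shifted : ∀ i → coeff (false ∷ (p * q)) i ≡ false
  shifted zero    = refl
  shifted (suc i) = *-zeroʳ p q e i

*-congˡ : ∀ p p′ q → p ≈ p′ → p * q ≈ p′ * q
*-congˡ []      p′       q e i = sym (*-zeroˡ p′ q (≈-sym [] p′ e) i)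
*-congˡ (a ∷ p) []       q e i = *-zeroˡ (a ∷ p) q e i
*-congˡ (a ∷ p) (b ∷ p′) q e i with e 0
... | refl = trans (coeff-* a p q i) (trans
  (cong ((a ∧ coeff q i) xor_)
    (∷-cong false (p * q) (p′ * q) (*-congˡ p p′ q (λ j → e (suc j))) i))
  (sym (coeff-* a p′ q i)))

*-congʳ : ∀ p q q′ → q ≈ q′ → p * q ≈ p * q′
*-congʳ []      q q′ e i = refl
*-congʳ (a ∷ p) q q′ e i = trans (coeff-* a p q i) (trans
  (cong₂ _xor_ (cong (a ∧_) (e i))
    (∷-cong false (p * q) (p * q′) (*-congʳ p q q′ e) i))
  (sym (coeff-* a p q′ i)))

∣-respˡ : ∀ {d d′ A} → d ≈ d′ → d ∣ A → d′ ∣ A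
∣-respˡ {d} {d′} {A} e (q , eq) =
  q , ≈-trans (q * d′) (q * d) A (*-congʳ q d′ d (≈-sym d d′ e)) eq

∣-respʳ : ∀ {d A A′} → A ≈ A′ → d ∣ A → d ∣ A′
∣-respʳ {d} {A} {A′} e (q , eq) = q , ≈-trans (q * d) A A′ eq e

-- p has degree < n
Bounded : ℕ → Poly → Set
Bounded n p = ∀ i → n ℕ.≤ i → coeff p i ≡ false

bounded-length : ∀ p → Bounded (length p) p
bounded-length []      i       _         = refl
bounded-length (a ∷ p) (suc i) (s≤s n≤i) = bounded-length p i n≤i

degree : ∀ p → p ≈ [] ⊎ Monic p
degree [] = inj₁ λ _ → refl
degree (a ∷ p) with degree p
degree (a     ∷ p) | inj₂ (n , top , above) =
  inj₂ (suc n , top , λ { (suc i) n<i → above i (s<s⁻¹ n<i) })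
degree (true  ∷ p) | inj₁ e = inj₂ (0 , refl , λ { (suc i) _ → e i })
degree (false ∷ p) | inj₁ e = inj₁ λ { zero → refl ; (suc i) → e i }

monic⇒≉0 : ∀ p → Monic p → p ≉ 0#
monic⇒≉0 p (n , top , _) e with trans (sym top) (e n)
... | ()

top-* : ∀ p q m n →
        coeff p m ≡ true → (∀ i → m ℕ.< i → coeff p i ≡ false) →
        coeff q n ≡ true → (∀ i → n ℕ.< i → coeff q i ≡ false) →
        coeff (p * q) (m ℕ.+ n) ≡ true
top-* (a ∷ p) q zero    n refl p↑ q≡ q↑ = trans (coeff-* true p q n)
  (cong₂ _xor_ q≡ (shifted n))
  where
  shifted : ∀ i → coeff (false ∷ (p * q)) i ≡ false
  shifted zero    = refl
  shifted (suc i) = *-zeroˡ p q (λ j → p↑ (suc j) (s≤s z≤n)) i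
top-* (a ∷ p) q (suc m) n p≡ p↑ q≡ q↑ = trans (coeff-* a p q (suc (m ℕ.+ n)))
  (cong₂ _xor_
    (trans (cong (a ∧_) (q↑ _ (s≤s (ℕ.m≤n+m n m)))) (Bool.∧-zeroʳ a))
    (top-* p q m n p≡ (λ i m<i → p↑ (suc i) (s≤s m<i)) q≡ q↑))

degree-sum : ∀ p q A n → ((m , _) : Monic p) → ((k , _) : Monic q) →
             p * q ≈ A → Bounded n A → m ℕ.+ k ℕ.< n
degree-sum p q A n (m , p≡ , p↑) (k , q≡ , q↑) e b with n ℕ.≤? m ℕ.+ k
... | no n≰ = ℕ.≰⇒> n≰
... | yes n≤ with trans (sym (top-* p q m k p≡ p↑ q≡ q↑)) (trans (e (m ℕ.+ k)) (b _ n≤))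
...   | ()

bounded-0 : ∀ {n} p → p ≈ [] → Bounded n p
bounded-0 p e i _ = e i

bounded-quotient : ∀ q d A → Monic d → q * d ≈ A → Bounded (length A) q
bounded-quotient q d A Md e with degree q
... | inj₁ q≈0 = bounded-0 q q≈0
... | inj₂ Mq@(m , _ , q↑) = λ i n≤i →
  q↑ i (ℕ.<-≤-trans (ℕ.≤-<-trans (ℕ.m≤m+n m _)
    (degree-sum q d A (length A) Mq Md e (bounded-length A))) n≤i)

bounded-divisor : ∀ d A → A ≉ 0# → d ∣ A → Bounded (length A) d
bounded-divisor d A A≉0 (q , e) with degree d
... | inj₁ d≈0 = bounded-0 d d≈0
... | inj₂ Md@(k , _ , d↑) with degree q
...   | inj₁ q≈0 = ⊥-elim (A≉0 (≈-trans A (q * d) []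
                     (≈-sym (q * d) A e) (*-zeroˡ q d q≈0)))
...   | inj₂ Mq = λ i n≤i →
  d↑ i (ℕ.<-≤-trans (ℕ.≤-<-trans (ℕ.m≤n+m k _)
    (degree-sum q d A (length A) Mq Md e (bounded-length A))) n≤i)

≈0? : ∀ p → Dec (p ≈ [])
≈0? p with degree p
... | inj₁ e = yes e
... | inj₂ M = no (monic⇒≉0 p M)

infix 4 _≈?_
_≈?_ : ∀ p q → Dec (p ≈ q)
[]      ≈? q       = map′ (≈-sym q []) (≈-sym [] q) (≈0? q)
(a ∷ p) ≈? []      = ≈0? (a ∷ p)
(a ∷ p) ≈? (b ∷ q) = map′ (λ { (refl , e) → ∷-cong a p q e })
                          (λ e → e 0 , λ i → e (suc i))
                          ((a Bool.≟ b) ×-dec (p ≈? q))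

monic? : Decidable Monic
monic? p with degree p
... | inj₁ e = no λ M → monic⇒≉0 p M e
... | inj₂ M = yes M

polys-complete : ∀ n p → (∀ i → n ℕ.≤ i → coeff p i ≡ false) →
                 ∃ λ p′ → p′ ∈ polys n × p ≈ p′
polys-complete zero    p       b = [] , here refl , λ i → b i z≤n
polys-complete (suc n) []      b with polys-complete n [] (λ _ _ → refl)
... | p′ , p′∈ , e = false ∷ p′ , ∈-++⁺ˡ (∈-map⁺ (false ∷_) p′∈) ,
                     λ { zero → refl ; (suc i) → e i }
polys-complete (suc n) (a ∷ p) b with polys-complete n p (λ i n≤i → b (suc i) (s≤s n≤i))
polys-complete (suc n) (false ∷ p) b | p′ , p′∈ , e =
  false ∷ p′ , ∈-++⁺ˡ (∈-map⁺ (false ∷_) p′∈) , ∷-cong false p p′ e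
polys-complete (suc n) (true ∷ p) b | p′ , p′∈ , e =
  true ∷ p′ , ∈-++⁺ʳ (map (false ∷_) (polys n)) (∈-map⁺ (true ∷_) p′∈) , ∷-cong true p p′ e

polys-unique : ∀ n → AllPairs _≉_ (polys n)
polys-unique zero    = All.[] AllPairs.∷ AllPairs.[]
polys-unique (suc n) = AllPairs.++⁺ (cons false) (cons true)
  (All.map⁺ (All.universal (λ p → All.map⁺ (All.universal (λ q → distinct p q) (polys n))) (polys n)))
  where
  cons : ∀ a → AllPairs _≉_ (map (a ∷_) (polys n))
  cons a = AllPairs.map⁺ (AllPairs.map (λ p≉q e → p≉q λ i → e (suc i)) (polys-unique n))
  distinct : ∀ p q → (false ∷ p) ≉ (true ∷ q)
  distinct p q e with e 0
  ... | ()

search : ∀ {P : Poly → Set} n → Decidable P →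
         (∀ {p p′} → p ≈ p′ → P p → P p′) → (∀ p → P p → Bounded n p) → Dec (∃ P)
search {P} n P? resp bound = map′
  (λ any → let p , _ , Pp = find any in p , Pp)
  (λ (p , Pp) → let p′ , p′∈ , e = polys-complete n p (bound p Pp)
                in lose p′∈ (resp e Pp))
  (Any.any? P? (polys n))

infix 4 _∣?_
_∣?_ : ∀ d A → Dec (d ∣ A)
d ∣? A with degree d
... | inj₁ d≈0 = map′
  (λ A≈0 → [] , ≈-sym A [] A≈0)
  (λ (q , e) → ≈-trans A (q * d) [] (≈-sym (q * d) A e) (*-zeroʳ q d d≈0))
  (≈0? A)
... | inj₂ Md = map′ (λ (q , e) → q , e) (λ (q , e) → q , e)
  (search (length A) (λ q → q * d ≈? A)
    (λ {q} {q′} e f → ≈-trans (q′ * d) (q * d) A (*-congˡ q′ q d (≈-sym q q′ e)) f)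
    (λ q → bounded-quotient q d A Md))

1∣ : ∀ p → 1# ∣ p
1∣ p = p , *-identityʳ p
  where
  *-identityʳ : ∀ p → p * 1# ≈ p
  *-identityʳ []      i       = refl
  *-identityʳ (a ∷ p) zero    = trans (Bool.xor-identityʳ _) (Bool.∧-identityʳ a)
  *-identityʳ (a ∷ p) (suc i) = *-identityʳ p i

gcd≡1? : ∀ d q → Monic d → Dec (IsGCD d q 1#)
gcd≡1? d q Md = map′ to from
  (All.all? (λ e → (e ∣? d) →-dec ((e ∣? q) →-dec (e ∣? 1#))) (polys (length d)))
  where
  to : All (λ e → e ∣ d → e ∣ q → e ∣ 1#) (polys (length d)) → IsGCD d q 1#
  to h = record
    { monic    = 0 , refl , λ { (suc _) _ → refl }
    ; divides₁ = 1∣ d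
    ; divides₂ = 1∣ q
    ; greatest = λ e e∣d e∣q →
        let e′ , e′∈ , eq = polys-complete (length d) e
                              (bounded-divisor e d (monic⇒≉0 d Md) e∣d)
        in ∣-respˡ (≈-sym e e′ eq)
             (All.lookup h e′∈ (∣-respˡ eq e∣d) (∣-respˡ eq e∣q))
    }
  from : IsGCD d q 1# → All (λ e → e ∣ d → e ∣ q → e ∣ 1#) (polys (length d))
  from G = All.universal (IsGCD.greatest G) (polys (length d))

gcd≡1-resp : ∀ {d d′ q q′} → d ≈ d′ → q ≈ q′ → IsGCD d q 1# → IsGCD d′ q′ 1#
gcd≡1-resp {d} {d′} {q} {q′} e f G = record
  { monic    = IsGCD.monic G
  ; divides₁ = 1∣ d′
  ; divides₂ = 1∣ q′
  ; greatest = λ c c∣d′ c∣q′ → IsGCD.greatest G c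
      (∣-respʳ (≈-sym d d′ e) c∣d′) (∣-respʳ (≈-sym q q′ f) c∣q′)
  }

monic-resp : ∀ {d d′} → d ≈ d′ → Monic d → Monic d′
monic-resp e (n , top , above) =
  n , trans (sym (e n)) top , λ i n<i → trans (sym (e i)) (above i n<i)

unitaryDivisor-resp : ∀ {A d d′} → d ≈ d′ → UnitaryDivisor A d → UnitaryDivisor A d′
unitaryDivisor-resp {A} {d} {d′} e (Md , q , eq , G) =
  monic-resp {d} {d′} e Md , q ,
  ≈-trans (q * d′) (q * d) A (*-congʳ q d′ d (≈-sym d d′ e)) eq ,
  gcd≡1-resp {q = q} e (λ _ → refl) G

unitaryDivisor? : ∀ A → Decidable (UnitaryDivisor A)
unitaryDivisor? A d with monic? d
... | no ¬Md = no λ (Md , _) → ¬Md Md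
... | yes Md = map′ (Md ,_) proj₂
  (search (length A) (λ q → (q * d ≈? A) ×-dec gcd≡1? d q Md)
    (λ {q} {q′} e (f , G) →
      ≈-trans (q′ * d) (q * d) A (*-congˡ q′ q d (≈-sym q q′ e)) f ,
      gcd≡1-resp {d} (λ _ → refl) e G)
    (λ q (f , _) → bounded-quotient q d A Md f))

------------------------------------------------------------------------

-- For A ≉ 0# every divisor has degree < length A, so each unitary divisor
-- occurs here exactly once up to _≈_. (The list depends on the representative
-- of A only through the padding of its members by zeros.)
unitaryDivisors : Poly → List Poly
unitaryDivisors A = filter (unitaryDivisor? A) (polys (length A))

unitaryDivisors-sound : ∀ A {d} → d ∈ unitaryDivisors A → UnitaryDivisor A d
unitaryDivisors-sound A d∈ = proj₂ (∈-filter⁻ (unitaryDivisor? A) {xs = polys (length A)} d∈)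

unitaryDivisors-complete : ∀ A → A ≉ 0# → ∀ d → UnitaryDivisor A d →
                           ∃ λ d′ → d′ ∈ unitaryDivisors A × d ≈ d′
unitaryDivisors-complete A A≉0 d U@(_ , q , eq , _) =
  let d′ , d′∈ , e = polys-complete (length A) d (bounded-divisor d A A≉0 (q , eq))
  in d′ , ∈-filter⁺ (unitaryDivisor? A) d′∈ (unitaryDivisor-resp {A} {d} {d′} e U) , e

unitaryDivisors-unique : ∀ A → AllPairs _≉_ (unitaryDivisors A)
unitaryDivisors-unique A = AllPairs.filter⁺ (unitaryDivisor? A) (polys-unique (length A))

σ* : Poly → Poly
σ* A = foldr _+_ 0# (unitaryDivisors A)

UnitaryPerfect : Poly → Set
UnitaryPerfect A = A ≉ 0# × σ* A ≈ A

{-# OPTIONS --safe #-}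

-- If A(c) = 1, then d(c) = 1 for every divisor d of A, so σ*(A)(c) is the parity
-- of the number of unitary divisors of A. The involution d ↦ A/d on them has no
-- fixed point, since A/d = d together with gcd(d, A/d) = 1 makes d, hence A = d²,
-- constant. So σ*(A)(c) = 0 ≠ A(c), and a nonconstant unitary perfect polynomial
-- vanishes at both points of 𝔽₂.

module Submission where

open import Defs
open import Algebra.Bundles using (CommutativeRing)
open import Algebra.Bundles.Raw using (RawSemiring)
import Algebra.Definitions.RawMagma as MagmaDefs
import Algebra.Properties.CommutativeSemigroup as CommutativeSemigroupProperties
open import Data.Bool.Base using (Bool; true; false; _∧_; _xor_)
import Data.Bool.Properties as Bool
open import Data.Empty using (⊥-elim)
open import Data.List.Base using (List; []; _∷_; foldr; map)
open import Data.List.Membership.Propositional using (_∈_; lose)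
open import Data.List.Relation.Unary.All as All using (All; []; _∷_)
import Data.List.Relation.Unary.All.Properties as All
open import Data.List.Relation.Unary.AllPairs as AllPairs using (AllPairs; _∷_)
open import Data.List.Relation.Unary.Any using (Any; here; there)
open import Data.Nat.Base as ℕ using (zero; suc; s≤s; z≤n)
open import Data.Product.Base using (∃; _×_; _,_)
open import Data.Sum.Base using (inj₁; inj₂)
open import Function.Base using (_∘_)
open import Function.Bundles using (mk⇔)
open import Relation.Binary.PropositionalEquality
  using (_≡_; refl; sym; trans; cong; cong₂; module ≡-Reasoning)
open import Relation.Nullary using (¬_; does)
open import Relation.Nullary.Decidable using (dec-true; dec-false; does-⇔)
open import Relation.Unary using (Pred; Decidable)

open MagmaDefs (RawSemiring.*-rawMagma 𝔽₂[x]) using (_,_)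
open CommutativeSemigroupProperties
  (CommutativeRing.+-commutativeSemigroup Bool.xor-∧-commutativeRing)
  using (interchange; x∙yz≈y∙xz)

-- Commutativity, distributivity and cancellation in the polynomial ring

-- Mirror image of `coeff-*`, whose recursion is on the left factor; comparing the two expansions
-- gives commutativity by induction.
*-∷ʳ : ∀ p b q i →
       coeff (p * (b ∷ q)) i ≡ (b ∧ coeff p i) xor coeff (false ∷ (p * q)) i
*-∷ʳ []      b q zero    = cong (_xor false) (sym (Bool.∧-zeroʳ b))
*-∷ʳ []      b q (suc i) = cong (_xor false) (sym (Bool.∧-zeroʳ b))
*-∷ʳ (a ∷ p) b q zero    = cong (_xor false) (Bool.∧-comm a b)
*-∷ʳ (a ∷ p) b q (suc i) = begin
  coeff ((a ∷ p) * (b ∷ q)) (suc i)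
    ≡⟨ coeff-* a p (b ∷ q) (suc i) ⟩
  (a ∧ coeff q i) xor coeff (p * (b ∷ q)) i
    ≡⟨ cong ((a ∧ coeff q i) xor_) (*-∷ʳ p b q i) ⟩
  (a ∧ coeff q i) xor ((b ∧ coeff p i) xor coeff (false ∷ (p * q)) i)
    ≡⟨ x∙yz≈y∙xz (a ∧ coeff q i) (b ∧ coeff p i) (coeff (false ∷ (p * q)) i) ⟩
  (b ∧ coeff p i) xor ((a ∧ coeff q i) xor coeff (false ∷ (p * q)) i)
    ≡⟨ cong ((b ∧ coeff p i) xor_) (coeff-* a p q i) ⟨
  (b ∧ coeff p i) xor coeff ((a ∷ p) * q) i ∎
  where open ≡-Reasoning

*-comm : ∀ p q → p * q ≈ q * p
*-comm []      q i = sym (*-zeroʳ q [] (λ _ → refl) i)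
*-comm (a ∷ p) q i = trans (coeff-* a p q i) (trans
  (cong ((a ∧ coeff q i) xor_) (∷-cong false (p * q) (q * p) (*-comm p q) i))
  (sym (*-∷ʳ q a p i)))

*-identityˡ : ∀ p → 1# * p ≈ p
*-identityˡ p i = trans (coeff-* true [] p i) (trans (cong (coeff p i xor_) (shifted i))
                                                     (Bool.xor-identityʳ (coeff p i)))
  where
  shifted : ∀ i → coeff (false ∷ []) i ≡ false
  shifted zero    = refl
  shifted (suc i) = refl

*-distribʳ-+ : ∀ r p q i → coeff ((p + q) * r) i ≡ coeff (p * r) i xor coeff (q * r) i
*-distribʳ-+ r []      q       i = refl
*-distribʳ-+ r (a ∷ p) []      i = sym (Bool.xor-identityʳ _)
*-distribʳ-+ r (a ∷ p) (b ∷ q) i = begin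
  coeff (((a xor b) ∷ (p + q)) * r) i
    ≡⟨ coeff-* (a xor b) (p + q) r i ⟩
  ((a xor b) ∧ coeff r i) xor coeff (false ∷ ((p + q) * r)) i
    ≡⟨ cong₂ _xor_ (Bool.∧-distribʳ-xor (coeff r i) a b) (shifted i) ⟩
  ((a ∧ coeff r i) xor (b ∧ coeff r i)) xor
  (coeff (false ∷ (p * r)) i xor coeff (false ∷ (q * r)) i)
    ≡⟨ interchange (a ∧ coeff r i) (b ∧ coeff r i)
                   (coeff (false ∷ (p * r)) i) (coeff (false ∷ (q * r)) i) ⟩
  ((a ∧ coeff r i) xor coeff (false ∷ (p * r)) i) xor
  ((b ∧ coeff r i) xor coeff (false ∷ (q * r)) i)
    ≡⟨ cong₂ _xor_ (coeff-* a p r i) (coeff-* b q r i) ⟨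
  coeff ((a ∷ p) * r) i xor coeff ((b ∷ q) * r) i ∎
  where
  open ≡-Reasoning
  shifted : ∀ i → coeff (false ∷ ((p + q) * r)) i ≡
                  coeff (false ∷ (p * r)) i xor coeff (false ∷ (q * r)) i
  shifted zero    = refl
  shifted (suc i) = *-distribʳ-+ r p q i

xor≡false⇒≡ : ∀ a b → a xor b ≡ false → a ≡ b
xor≡false⇒≡ false b     e = sym e
xor≡false⇒≡ true  true  e = refl

-- In characteristic 2 the difference of `p` and `q` is `p + q`. If it were nonzero, its leading
-- term times that of `d` would survive in `(p + q) * d`, at `m + k`, where the hypothesis forces a
-- zero coefficient.
*-cancelʳ : ∀ p q d → Monic d → p * d ≈ q * d → p ≈ q
*-cancelʳ p q d (k , d≡ , d↑) e with degree (p + q)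
... | inj₁ z = λ i → xor≡false⇒≡ _ _ (trans (sym (coeff-+ p q i)) (z i))
... | inj₂ (m , s≡ , s↑)
  with trans (sym (top-* (p + q) d m k s≡ s↑ d≡ d↑))
         (trans (*-distribʳ-+ d p q (m ℕ.+ k))
           (trans (cong (_xor coeff (q * d) (m ℕ.+ k)) (e (m ℕ.+ k)))
             (Bool.xor-same (coeff (q * d) (m ℕ.+ k)))))
...   | ()

-- Over the field with two elements a leading coefficient can only be 1.
≉0⇒monic : ∀ p → p ≉ 0# → Monic p
≉0⇒monic p p≉0 with degree p
... | inj₁ z = ⊥-elim (p≉0 z)
... | inj₂ M = M

-- Evaluation and the factor theorem

eval-≈0 : ∀ p c → p ≈ [] → eval p c ≡ false
eval-≈0 []      c e = refl
eval-≈0 (a ∷ p) c e = trans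
  (cong₂ (λ u v → u xor (c ∧ v)) (e 0) (eval-≈0 p c (e ∘ suc))) (Bool.∧-zeroʳ c)

eval-cong : ∀ p q c → p ≈ q → eval p c ≡ eval q c
eval-cong []      q       c e = sym (eval-≈0 q c (≈-sym [] q e))
eval-cong (a ∷ p) []      c e = eval-≈0 (a ∷ p) c e
eval-cong (a ∷ p) (b ∷ q) c e =
  cong₂ (λ u v → u xor (c ∧ v)) (e 0) (eval-cong p q c (e ∘ suc))

eval-+ : ∀ p q c → eval (p + q) c ≡ eval p c xor eval q c
eval-+ []      q       c = refl
eval-+ (a ∷ p) []      c = sym (Bool.xor-identityʳ _)
eval-+ (a ∷ p) (b ∷ q) c = trans
  (cong ((a xor b) xor_) (trans (cong (c ∧_) (eval-+ p q c))
                                (Bool.∧-distribˡ-xor c (eval p c) (eval q c))))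
  (interchange a b (c ∧ eval p c) (c ∧ eval q c))

eval-scale : ∀ a p c → eval (map (a ∧_) p) c ≡ a ∧ eval p c
eval-scale false []      c = refl
eval-scale true  []      c = refl
eval-scale false (b ∷ p) c = trans (cong (c ∧_) (eval-scale false p c)) (Bool.∧-zeroʳ c)
eval-scale true  (b ∷ p) c = cong (λ v → b xor (c ∧ v)) (eval-scale true p c)

eval-* : ∀ p q c → eval (p * q) c ≡ eval p c ∧ eval q c
eval-* []      q c = refl
eval-* (a ∷ p) q c = begin
  eval (map (a ∧_) q + (false ∷ (p * q))) c
    ≡⟨ eval-+ (map (a ∧_) q) (false ∷ (p * q)) c ⟩
  eval (map (a ∧_) q) c xor (c ∧ eval (p * q) c)
    ≡⟨ cong₂ _xor_ (eval-scale a q c) (cong (c ∧_) (eval-* p q c)) ⟩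
  (a ∧ eval q c) xor (c ∧ (eval p c ∧ eval q c))
    ≡⟨ cong ((a ∧ eval q c) xor_) (Bool.∧-assoc c (eval p c) (eval q c)) ⟨
  (a ∧ eval q c) xor ((c ∧ eval p c) ∧ eval q c)
    ≡⟨ Bool.∧-distribʳ-xor (eval q c) a (c ∧ eval p c) ⟨
  (a xor (c ∧ eval p c)) ∧ eval q c ∎
  where open ≡-Reasoning

-- Quotient by X + c, computed by Horner's scheme.
quotient : Poly → 𝔽₂ → Poly
quotient []      c = []
quotient (a ∷ p) c = eval p c ∷ quotient p c

quotient-remainder : ∀ p c → quotient p c * (c ∷ 1#) ≈ p + (eval p c ∷ [])
quotient-remainder []      c zero    = refl
quotient-remainder []      c (suc i) = refl
quotient-remainder (a ∷ p) c zero    = begin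
  (v ∧ c) xor false       ≡⟨ Bool.xor-identityʳ (v ∧ c) ⟩
  v ∧ c                   ≡⟨ Bool.∧-comm v c ⟩
  c ∧ v                   ≡⟨ cong (_xor (c ∧ v)) (Bool.xor-same a) ⟨
  (a xor a) xor (c ∧ v)   ≡⟨ Bool.xor-assoc a a (c ∧ v) ⟩
  a xor (a xor (c ∧ v))   ∎
  where
  open ≡-Reasoning
  v : 𝔽₂
  v = eval p c
quotient-remainder (a ∷ p) c (suc i) = begin
  coeff ((v ∷ quotient p c) * (c ∷ 1#)) (suc i)
    ≡⟨ coeff-* v (quotient p c) (c ∷ 1#) (suc i) ⟩
  (v ∧ coeff 1# i) xor coeff (quotient p c * (c ∷ 1#)) i
    ≡⟨ cong ((v ∧ coeff 1# i) xor_) (quotient-remainder p c i) ⟩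
  (v ∧ coeff 1# i) xor coeff (p + (v ∷ [])) i
    -- The new leading entry `v` of the quotient list cancels the remainder `v` supplied by the
    -- induction hypothesis.
    ≡⟨ cong₂ _xor_ (unit i) (coeff-+ p (v ∷ []) i) ⟩
  coeff (v ∷ []) i xor (coeff p i xor coeff (v ∷ []) i)
    ≡⟨ x∙yz≈y∙xz (coeff (v ∷ []) i) (coeff p i) (coeff (v ∷ []) i) ⟩
  coeff p i xor (coeff (v ∷ []) i xor coeff (v ∷ []) i)
    ≡⟨ cong (coeff p i xor_) (Bool.xor-same (coeff (v ∷ []) i)) ⟩
  coeff p i xor false
    ≡⟨ coeff-+ p [] i ⟨
  coeff (p + []) i ∎
  where
  open ≡-Reasoning
  v : 𝔽₂
  v = eval p c
  unit : ∀ i → v ∧ coeff 1# i ≡ coeff (v ∷ []) i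
  unit zero    = Bool.∧-identityʳ v
  unit (suc i) = Bool.∧-zeroʳ v

root⇒∣ : ∀ A c → eval A c ≡ false → (c ∷ 1#) ∣ A
root⇒∣ A c r = quotient A c , λ i → begin
  coeff (quotient A c * (c ∷ 1#)) i     ≡⟨ quotient-remainder A c i ⟩
  coeff (A + (eval A c ∷ [])) i         ≡⟨ coeff-+ A (eval A c ∷ []) i ⟩
  coeff A i xor coeff (eval A c ∷ []) i ≡⟨ cong (coeff A i xor_) (remainder i) ⟩
  coeff A i xor false                   ≡⟨ Bool.xor-identityʳ (coeff A i) ⟩
  coeff A i                             ∎
  where
  open ≡-Reasoning
  remainder : ∀ i → coeff (eval A c ∷ []) i ≡ false
  remainder zero    = r
  remainder (suc i) = refl

-- Sums modulo 2 over lists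

⨁ : ∀ {a} {A : Set a} → (A → Bool) → List A → Bool
⨁ f []       = false
⨁ f (x ∷ xs) = f x xor ⨁ f xs

⨁-cong : ∀ {a} {A : Set a} {f g : A → Bool} {xs} →
         All (λ x → f x ≡ g x) xs → ⨁ f xs ≡ ⨁ g xs
⨁-cong []       = refl
⨁-cong (e ∷ es) = cong₂ _xor_ e (⨁-cong es)

⨁-xor : ∀ {a} {A : Set a} (f g : A → Bool) xs →
        ⨁ (λ x → f x xor g x) xs ≡ ⨁ f xs xor ⨁ g xs
⨁-xor f g []       = refl
⨁-xor f g (x ∷ xs) = trans (cong ((f x xor g x) xor_) (⨁-xor f g xs))
                           (interchange (f x) (g x) (⨁ f xs) (⨁ g xs))

-- Off-diagonal entries cancel in pairs `M x y`, `M y x`. The induction splits off the first row and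
-- column, which cancel each other.
⨁-symmetric : ∀ {a} {A : Set a} (M : A → A → Bool) → (∀ x y → M x y ≡ M y x) →
              ∀ {xs} → All (λ x → M x x ≡ false) xs → ⨁ (λ x → ⨁ (M x) xs) xs ≡ false
⨁-symmetric M M-sym                []                = refl
⨁-symmetric M M-sym {xs = x ∷ xs} (diag ∷ diags) = begin
  (M x x xor ⨁ (M x) xs) xor ⨁ (λ y → M y x xor ⨁ (M y) xs) xs
    ≡⟨ cong₂ _xor_ (cong (_xor ⨁ (M x) xs) diag)
                   (⨁-xor (λ y → M y x) (λ y → ⨁ (M y) xs) xs) ⟩
  ⨁ (M x) xs xor (⨁ (λ y → M y x) xs xor ⨁ (λ y → ⨁ (M y) xs) xs)
    ≡⟨ cong (⨁ (M x) xs xor_)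
         (cong₂ _xor_ (⨁-cong (All.universal (λ y → M-sym y x) xs))
                      (⨁-symmetric M M-sym diags)) ⟩
  ⨁ (M x) xs xor (⨁ (M x) xs xor false)
    ≡⟨ cong (⨁ (M x) xs xor_) (Bool.xor-identityʳ (⨁ (M x) xs)) ⟩
  ⨁ (M x) xs xor ⨁ (M x) xs
    ≡⟨ Bool.xor-same (⨁ (M x) xs) ⟩
  false ∎
  where open ≡-Reasoning

module _ {a p} {A : Set a} {P : Pred A p} (P? : Decidable P) where

  ⨁-none : ∀ {xs} → All (¬_ ∘ P) xs → ⨁ (does ∘ P?) xs ≡ false
  ⨁-none []                      = refl
  ⨁-none {xs = x ∷ _} (¬p ∷ ¬ps) = cong₂ _xor_ (dec-false (P? x) ¬p) (⨁-none ¬ps)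

  -- Pairwise exclusion allows at most one true term and `Any` supplies one, so the count is exactly
  -- 1.
  ⨁-unique : ∀ {xs} → AllPairs (λ x y → P x → ¬ P y) xs → Any P xs →
             ⨁ (does ∘ P?) xs ≡ true
  ⨁-unique {x ∷ _} (h ∷ _) (here px) =
    cong₂ _xor_ (dec-true (P? x) px) (⨁-none (All.map (λ f → f px) h))
  ⨁-unique {x ∷ _} (h ∷ hs) (there any) =
    cong₂ _xor_ (dec-false (P? x) λ px → All.All¬⇒¬Any (All.map (λ f → f px) h) any)
                (⨁-unique hs any)

eval-sum : ∀ c ps → eval (foldr _+_ 0# ps) c ≡ ⨁ (λ p → eval p c) ps
eval-sum c []       = refl
eval-sum c (p ∷ ps) = trans (eval-+ p (foldr _+_ 0# ps) c)
                            (cong (eval p c xor_) (eval-sum c ps))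

-- Cofactors and squares of unitary divisors

unit⇒constant : ∀ d → d ∣ 1# → Constant d
unit⇒constant d (k , e) = coeff d 0 , λ { zero → refl ; (suc i) → bounded (suc i) (s≤s z≤n) }
  where
  bounded : Bounded 1 d
  bounded = bounded-divisor d 1# (monic⇒≉0 1# (0 , refl , λ { (suc _) _ → refl })) (k , e)

*-constant : ∀ p q → Constant p → Constant q → Constant (p * q)
-- The trailing `xor false` is how the product of two one-entry lists computes.
*-constant p q (a , e) (b , f) = (a ∧ b) xor false , λ i →
  trans (*-congˡ p (a ∷ []) q e i) (*-congʳ (a ∷ []) q (b ∷ []) f i)

-- Coprimality is symmetric in a divisor and its cofactor, so the involution stays within the
-- unitary divisors.
cofactor-unitary : ∀ A d q → A ≉ 0# → q * d ≈ A → IsGCD d q 1# → UnitaryDivisor A q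
cofactor-unitary A d q A≉0 e G =
  ≉0⇒monic q (λ z → A≉0 λ i → trans (sym (e i)) (*-zeroˡ q d z i)) , d ,
  ≈-trans (d * q) (q * d) A (*-comm d q) e ,
  record
    { monic    = IsGCD.monic G
    ; divides₁ = IsGCD.divides₂ G
    ; divides₂ = IsGCD.divides₁ G
    ; greatest = λ u u∣q u∣d → IsGCD.greatest G u u∣d u∣q
    }

unitary-square : ∀ A d → UnitaryDivisor A d → d * d ≈ A → Constant A
unitary-square A d (Md , q , e , G) sq =
  let d≈q     = *-cancelʳ d q d Md (≈-trans (d * d) A (q * d) sq (≈-sym (q * d) A e))
      d∣d     = 1# , *-identityˡ d
      -- As `d ≈ q`, `d` is a common divisor of itself and its cofactor, and so divides `1#`.
      d-const = unit⇒constant d (IsGCD.greatest G d d∣d (∣-respʳ d≈q d∣d))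
      b , d²≈ = *-constant d d d-const d-const
  in b , ≈-trans A (d * d) (b ∷ []) (≈-sym (d * d) A sq) d²≈

-- Parity of the number of unitary divisors

module _ (A : Poly) (¬C : ¬ Constant A) (A≉0 : A ≉ 0#) where

  private
    L : List Poly
    L = unitaryDivisors A

  -- Existence comes from completeness of the list, uniqueness from cancelling `d`.
  one-cofactor : ∀ {d} → d ∈ L → ⨁ (λ e → does (d * e ≈? A)) L ≡ true
  one-cofactor {d} d∈ =
    let Md , q , e , G = unitaryDivisors-sound A d∈
        q′ , q′∈ , q≈q′ = unitaryDivisors-complete A A≉0 q (cofactor-unitary A d q A≉0 e G)
    in ⨁-unique (λ e → d * e ≈? A)
         (AllPairs.map (λ {x} {y} x≉y dx≈A dy≈A → x≉y (*-cancelʳ x y d Md λ i →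
            trans (*-comm x d i) (trans (dx≈A i) (trans (sym (dy≈A i)) (*-comm d y i)))))
           (unitaryDivisors-unique A))
         -- The list contains a representative `q′` of the cofactor, not necessarily `q` itself.
         (lose q′∈ λ i → trans (*-congʳ d q′ q (≈-sym q q′ q≈q′) i)
                               (trans (*-comm d q i) (e i)))

  -- The sum over pairs (d, e) of [d e = A] has one term equal to 1 for each d,
  -- and its symmetric matrix has zero diagonal.
  unitaryDivisors-even : ⨁ (λ _ → true) L ≡ false
  unitaryDivisors-even = trans
    (⨁-cong (All.tabulate λ d∈ → sym (one-cofactor d∈)))
    (⨁-symmetric (λ d e → does (d * e ≈? A))
      (λ d e → does-⇔ (mk⇔ (≈-trans (e * d) (d * e) A (*-comm e d))
                           (≈-trans (d * e) (e * d) A (*-comm d e)))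
                      (d * e ≈? A) (e * d ≈? A))
      -- A diagonal entry 1 would make `A` the square of a unitary divisor, hence constant.
      (All.tabulate λ {d} d∈ → dec-false (d * d ≈? A)
        (¬C ∘ unitary-square A d (unitaryDivisors-sound A d∈))))

  eval-σ* : ∀ c → eval A c ≡ true → eval (σ* A) c ≡ false
  eval-σ* c A[c]≡1 = trans (eval-sum c L)
    (trans (⨁-cong (All.tabulate λ d∈ → divisor[c]≡1 (unitaryDivisors-sound A d∈)))
           unitaryDivisors-even)
    where
    divisor[c]≡1 : ∀ {d} → UnitaryDivisor A d → eval d c ≡ true
    -- The product of the values of `q` and `d` at `c` is 1, which forces both to be 1.
    divisor[c]≡1 {d} (_ , q , e , _) = Bool.∧-conicalʳ (eval q c) (eval d c)
      (trans (sym (eval-* q d c)) (trans (eval-cong (q * d) A c e) A[c]≡1))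

unitaryPerfect-root : ∀ A → ¬ Constant A → UnitaryPerfect A → ∀ c → eval A c ≡ false
unitaryPerfect-root A ¬C (A≉0 , perfect) c with eval A c in eq
... | false = refl
-- Contradictory case: `A` has value 1 at `c`, but the equivalent `σ* A` has value 0.
... | true  = trans (sym eq) (trans (sym (eval-cong (σ* A) A c perfect)) (eval-σ* A ¬C A≉0 c eq))

lemma2p9 : (∀ A → ¬ Constant A → UnitaryPerfect A → X ∣ A × (X + 1#) ∣ A)
    × ¬ (∃ λ A → Odd A × ¬ Constant A × UnitaryPerfect A)
lemma2p9 =
  -- `X` and `X + 1#` compute to `c ∷ 1#` with `c` equal to `false` and `true`.
  (λ A ¬C U → root⇒∣ A false (unitaryPerfect-root A ¬C U false) ,
              root⇒∣ A true  (unitaryPerfect-root A ¬C U true)) ,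
  λ (A , odd , ¬C , U) → odd (false , unitaryPerfect-root A ¬C U false)
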